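{- In $\mathsf{HPAL}$, for every $\varphi\in\mathcal{L}^{\div}$: if $\neg\varphi$ is preserved, then $\varphi$ is successful. That is, if $\neg\varphi\to[\div\neg\neg\varphi]\neg\varphi$ is valid in the class of all Kripke models, then for every $a\in Ag$ the formula $\exists\neg\varphi\to[\div\varphi]\neg B_a\varphi$ is valid in the class of all Kripke models.
   Context: Language. $At$ is a countable set of atoms, $Ag$ a finite set of agents. The contraction language $\mathcal{L}^{\div}$ is given by $\varphi::=\top\mid p\mid\neg\varphi\mid\varphi\wedge\varphi\mid B_a\varphi\mid[\div\varphi]\varphi\mid\forall\varphi$ with $p\in At$, $a\in Ag$; $\exists\varphi:=\neg\forall\neg\varphi$; the other Boolean connectives are the usual abbreviations. Semantics. A Kripke model is $\mathcal{M}=(W,R,V)$ with $W\neq\emptyset$, $R_a\subseteq W\times W$ an arbitrary relation for each $a\in Ag$, $V:At\to\wp(W)$; $R_a(w)=\{v:(w,v)\in R_a\}$. Atoms and Booleans are standard; $\mathcal{M},w\vDash B_a\varphi$ iff $\mathcal{M},v\vDash\varphi$ for all $v\in R_a(w)$; $\mathcal{M},w\vDash\forall\varphi$ iff $\mathcal{M},v\vDash\varphi$ for all $v\in W$; $\mathcal{M},w\vDash[\div\varphi]\psi$ iff $\mathcal{M}^{\div\varphi},w\vDash\psi$, where $\mathcal{M}^{\div\varphi}=(W,R^{\div\varphi},V)$ with $R_a^{\div\varphi}(w)=R_a(w)\cup\{v\in W:\mathcal{M},v\vDash\neg\varphi\}$ if $\mathcal{M},w\vDash B_a\varphi$, and $R_a^{\div\varphi}(w)=R_a(w)$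 otherwise. A formula is valid in a class of models if it is true at every world of every model in the class. $\mathsf{HPAL}$ is the logic of contraction updates over the class of all Kripke models. A formula $\psi$ is preserved (in $\mathsf{HPAL}$) if $\psi\to[\div\neg\psi]\psi$ is valid in the class of all Kripke models. A formula $\varphi$ is successful (in $\mathsf{HPAL}$) if $\exists\neg\varphi\to[\div\varphi]\neg B_a\varphi$ is valid in the class of all Kripke models for all $a\in Ag$. -}

module Defs where

open import Level using (Level) renaming (suc to lsuc)
open import Data.Nat using (ℕ)
open import Data.Fin using (Fin)
open import Data.Product using (_×_; ∃-syntax)
open import Data.Sum using (_⊎_)
open import Data.Unit.Polymorphic using () renaming (⊤ to Unit)
open import Function.Bundles using (_↣_; _↔_)
open import Relation.Nullary using (¬_)
open import Relation.Unary using (Pred)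
open import Relation.Binary using (Rel)

-- At most countable: finite sets of atoms are included.
Countable : Set → Set
Countable A = A ↣ ℕ

Finite : Set → Set
Finite A = ∃[ n ] (A ↔ Fin n)

infix  30 ~_
infixr 25 _∧_

data Formula (At Ag : Set) : Set where
  ⊤′    : Formula At Ag
  atom  : At → Formula At Ag
  ~_    : Formula At Ag → Formula At Ag
  _∧_   : Formula At Ag → Formula At Ag → Formula At Ag
  B     : Ag → Formula At Ag → Formula At Ag
  [÷_]_ : Formula At Ag → Formula At Ag → Formula At Ag
  A     : Formula At Ag → Formula At Ag

module _ {At Ag : Set} where

  infixr 20 _⇒_

  _⇒_ : Formula At Ag → Formula At Ag → Formula At Ag
  φ ⇒ ψ = ~ (φ ∧ ~ ψ)

  E : Formula At Ag → Formula At Ag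
  E φ = ~ (A (~ φ))

record Model (At Ag : Set) (ℓ : Level) : Set (lsuc ℓ) where
  field
    W        : Set ℓ
    nonempty : W
    R        : Ag → Rel W ℓ
    V        : At → Pred W ℓ

open Model public

module _ {At Ag : Set} {ℓ : Level} where

  infix 10 _,_⊨_

  _^÷_  : Model At Ag ℓ → Formula At Ag → Model At Ag ℓ
  _,_⊨_ : (M : Model At Ag ℓ) → W M → Formula At Ag → Set ℓ

  -- The premise ∀ u → R M a w u → M , u ⊨ φ is M , w ⊨ B a φ written out, so
  -- that the recursion is structural. When it fails the right summand is
  -- empty, so the successors of w are unchanged.
  M ^÷ φ = record
    { W        = W M
    ; nonempty = nonempty M
    ; R        = λ a w v →
        R M a w v ⊎ ((∀ u → R M a w u → M , u ⊨ φ) × ¬ (M , v ⊨ φ))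
    ; V        = V M
    }

  M , w ⊨ ⊤′         = Unit
  M , w ⊨ atom p     = V M p w
  M , w ⊨ (~ φ)      = ¬ (M , w ⊨ φ)
  M , w ⊨ (φ ∧ ψ)    = (M , w ⊨ φ) × (M , w ⊨ ψ)
  M , w ⊨ B a φ      = ∀ v → R M a w v → M , v ⊨ φ
  M , w ⊨ ([÷ φ ] ψ) = (M ^÷ φ) , w ⊨ ψ
  M , w ⊨ A φ        = ∀ v → M , v ⊨ φ

module _ {At Ag : Set} (ℓ : Level) where

  Valid : Formula At Ag → Set (lsuc ℓ)
  Valid φ = (M : Model At Ag ℓ) (w : W M) → M , w ⊨ φ

  Preserved : Formula At Ag → Set (lsuc ℓ)
  Preserved ψ = Valid (ψ ⇒ [÷ ~ ψ ] ψ)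

  Successful : Formula At Ag → Set (lsuc ℓ)
  Successful φ = (a : Ag) → Valid (E (~ φ) ⇒ [÷ φ ] (~ B a φ))

{-# OPTIONS --safe #-}

-- By excluded middle, contracting with φ and with ~ ~ φ gives the same
-- successors. If ~ φ is preserved, then every world satisfying φ after
-- contraction satisfied φ before it. So if a believed φ at w after the
-- contraction, all old successors of w would already satisfy φ; then every
-- ~ φ-world would become a successor of w and hence satisfy φ, so that there
-- would be no ~ φ-world at all.
module Submission where

open import Level using (Level)
open import Axiom.ExcludedMiddle using (ExcludedMiddle)
open import Axiom.DoubleNegationElimination using (em⇒dne)
open import Data.Product using (_,_)
open import Data.Product.Function.NonDependent.Propositional using (_×-⇔_)
open import Data.Sum using (inj₁; inj₂)
open import Data.Sum.Function.Propositional using (_⊎-⇔_)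
open import Function.Bundles using (_⇔_; mk⇔; module Equivalence)
open import Function.Construct.Identity using (⇔-id)
open import Function.Related.TypeIsomorphisms using (¬-cong-⇔; →-cong-⇔)
open import Relation.Binary using (Rel)
open import Defs

open Equivalence using (to; from)

Π-cong-⇔ : ∀ {a b c} {X : Set a} {P : X → Set b} {Q : X → Set c} →
           (∀ x → P x ⇔ Q x) → (∀ x → P x) ⇔ (∀ x → Q x)
Π-cong-⇔ P⇔Q = mk⇔ (λ p x → to (P⇔Q x) (p x)) (λ q x → from (P⇔Q x) (q x))

module _ {At Ag : Set} {ℓ : Level} where

  -- Worlds and valuation stay definitionally fixed, so both models are compared at the same `w`. By
  -- eta, `M ^÷ ψ` is `M ^÷ φ` with its relations replaced.
  withRelations : (M : Model At Ag ℓ) → (Ag → Rel (W M) ℓ) → Model At Ag ℓ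
  withRelations M S = record M { R = S }

  ⊨-cong : (φ : Formula At Ag) (M : Model At Ag ℓ) (S : Ag → Rel (W M) ℓ) →
           (∀ a w v → R M a w v ⇔ S a w v) →
           ∀ w → (M , w ⊨ φ) ⇔ (withRelations M S , w ⊨ φ)
  ⊨-cong ⊤′         M S R⇔S w = ⇔-id _
  ⊨-cong (atom p)   M S R⇔S w = ⇔-id _
  ⊨-cong (~ φ)      M S R⇔S w = ¬-cong-⇔ (⊨-cong φ M S R⇔S w)
  ⊨-cong (φ ∧ ψ)    M S R⇔S w = ⊨-cong φ M S R⇔S w ×-⇔ ⊨-cong ψ M S R⇔S w
  ⊨-cong (B a φ)    M S R⇔S w =
    Π-cong-⇔ λ v → →-cong-⇔ (R⇔S a w v) (⊨-cong φ M S R⇔S v)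
  ⊨-cong ([÷ φ ] ψ) M S R⇔S w =
    -- The induction keeps `M` and `S` general for this case: the hypothesis for `φ` makes the
    -- contracted relations equivalent, and the one for `ψ` is applied to them.
    ⊨-cong ψ (M ^÷ φ) (R (withRelations M S ^÷ φ))
      (λ a u v → R⇔S a u v ⊎-⇔
        (Π-cong-⇔ (λ x → →-cong-⇔ (R⇔S a u x) (⊨-cong φ M S R⇔S x))
          ×-⇔ ¬-cong-⇔ (⊨-cong φ M S R⇔S v)))
      w
  ⊨-cong (A φ)      M S R⇔S w = Π-cong-⇔ (⊨-cong φ M S R⇔S)

  ^÷-cong : (M : Model At Ag ℓ) (φ ψ : Formula At Ag) →
            (∀ w → (M , w ⊨ φ) ⇔ (M , w ⊨ ψ)) →
            ∀ χ w → (M ^÷ φ , w ⊨ χ) ⇔ (M ^÷ ψ , w ⊨ χ)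
  ^÷-cong M φ ψ φ⇔ψ χ = ⊨-cong χ (M ^÷ φ) (R (M ^÷ ψ)) λ a w v →
    ⇔-id _ ⊎-⇔
      (Π-cong-⇔ (λ u → →-cong-⇔ (⇔-id _) (φ⇔ψ u)) ×-⇔ ¬-cong-⇔ (φ⇔ψ v))

proposition6p1 : {ℓ : Level} → ExcludedMiddle ℓ →
    (At Ag : Set) → Countable At → Finite Ag →
    (φ : Formula At Ag) → Preserved ℓ (~ φ) → Successful ℓ φ
proposition6p1 em At Ag _ _ φ preserved a M w (∃¬φ , ¬¬Bφ) =
  ∃¬φ λ v ¬φv → ¬φv (reflect v (Bφ v (inj₂ (Bφ-before , ¬φv))))
  where
  dne = em⇒dne em

  reflect : ∀ v → M ^÷ φ , v ⊨ φ → M , v ⊨ φ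
  -- Preservation of `~ φ` speaks of contraction with `~ ~ φ`, so `φv` is first carried over to that
  -- model, where it refutes the `~ φ` that preservation would give.
  reflect v φv = dne λ ¬φv → preserved M v
    (¬φv , λ ¬φv′ → ¬φv′ (to (^÷-cong M φ (~ ~ φ) φ⇔¬¬φ φ v) φv))
    where
    φ⇔¬¬φ : ∀ u → (M , u ⊨ φ) ⇔ (M , u ⊨ ~ ~ φ)
    φ⇔¬¬φ u = mk⇔ (λ φu ¬φu → ¬φu φu) dne

  Bφ : M ^÷ φ , w ⊨ B a φ
  Bφ = dne ¬¬Bφ

  Bφ-before : M , w ⊨ B a φ
  Bφ-before v Rwv = reflect v (Bφ v (inj₁ Rwv))
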